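{- Let $(R_1,\mathcal L_1)$ and $(R_2,\mathcal L_2)$ be sets with a language. Let $d:R_1\to R_2$ be an injective map such that: (1) for every constant $c\in\mathcal L_1$, the element $d(c)$ can be defined by $\mathcal L_2$, i.e. $\{d(c)\}\subset R_2$ is a Diophantine set; (2) for every function $f:R_1^k\to R_1$ of $\mathcal L_1$, the set $\{(d(x_1),\ldots,d(x_k),d(f(x_1,\ldots,x_k)))\mid (x_1,\ldots,x_k)\in R_1^k\}\subset R_2^{k+1}$ is Diophantine; (3) for every relation $S\subset R_1^k$ of $\mathcal L_1$, the set $d(S)\subset R_2^k$ is Diophantine; (4) the set $d(R_1)\subset R_2$ is Diophantine. Then $d$ is a Diophantine map.
   Context: A "set with a language" $(R,\mathcal L)$ is a set $R$ together with a language $\mathcal L$ (constants, function symbols, relation symbols) with an interpretation in $R$; every language contains a constant $0$ and the equality relation $=$. Symbols are identified with their interpretations. A term of $\mathcal L$ is built from constants of $\mathcal L$ and variables using functions of $\mathcal L$. A basic formula is one of the form $(t_1,\ldots,t_k)\in R'$ with $R'\in\mathcal L$ a $k$-ary relation (possibly equality) and $t_i$ terms of $\mathcal L$. A set $S\subset R^k$ is Diophantine (with respect to $\mathcal L$) if there are basic formulas $f_1,\ldots,f_r$ with $S=\{(x_1,\ldots,x_k)\in R^k\mid \exists y_1,\ldots,y_l\in R\ (f_1\wedge\cdots\wedge f_r)\}$. For a map $d:R_1\to R_2$ and $S\subset R_1^k$, $d(S)=\{(d(x_1),\ldots,d(x_k))\mid (x_1,\ldots,x_k)\in S\}$. A map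 $d:R_1\to R_2$ is a Diophantine map if for all $k$ and all Diophantine sets $S\subset R_1^k$ the set $d(S)\subset R_2^k$ is Diophantine. -}

module Defs where

open import Level using (Level; _⊔_) renaming (suc to lsuc)
open import Data.Nat.Base using (ℕ; _+_)
open import Data.Fin.Base using (Fin)
open import Data.Vec.Base using (Vec; []; _∷_; _++_; _∷ʳ_; lookup; map)
open import Data.List.Base using (List)
open import Data.List.Relation.Unary.All using (All)
open import Data.Product.Base using (∃; ∃-syntax; _×_)
open import Function.Bundles using (_⇔_)
open import Relation.Unary using (Pred; _∈_; _≐_)
open import Relation.Binary.PropositionalEquality.Core using (_≡_)

-- Symbols are families of names indexed by arity.  Constants are kept apart
-- from functions, and arity 0 is not excluded for functions and relations.
-- Equality is one of the relation symbols, so a quantifier over the relations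
-- of the language covers it; `rel-eq` pins its interpretation.

record SetWithLanguage (a s ℓ : Level) : Set (lsuc (a ⊔ s ⊔ ℓ)) where
  field
    Carrier : Set a

    Con : Set s
    Fun : ℕ → Set s
    Rel : ℕ → Set s

    con : Con → Carrier
    fun : ∀ {k} → Fun k → Vec Carrier k → Carrier
    rel : ∀ {k} → Rel k → Pred (Vec Carrier k) ℓ

    zeroᶜ  : Con
    eqᴿ    : Rel 2
    rel-eq : ∀ x y → (x ∷ y ∷ []) ∈ rel eqᴿ ⇔ x ≡ y

module _ {a s ℓ : Level} (𝓡 : SetWithLanguage a s ℓ) where
  open SetWithLanguage 𝓡

  data Term (n : ℕ) : Set s where
    var   : Fin n → Term n
    const : Con → Term n
    app   : ∀ {k} → Fun k → Vec (Term n) k → Term n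

  data BasicFormula (n : ℕ) : Set s where
    atom : ∀ {k} → Rel k → Vec (Term n) k → BasicFormula n

module _ {a s ℓ : Level} {𝓡 : SetWithLanguage a s ℓ} where
  open SetWithLanguage 𝓡

  eval  : ∀ {n} → Vec Carrier n → Term 𝓡 n → Carrier
  -- `map (eval ρ)`, unfolded for the termination checker
  evals : ∀ {n k} → Vec Carrier n → Vec (Term 𝓡 n) k → Vec Carrier k

  eval ρ (var i)    = lookup ρ i
  eval ρ (const c)  = con c
  eval ρ (app f ts) = fun f (evals ρ ts)

  evals ρ []       = []
  evals ρ (t ∷ ts) = eval ρ t ∷ evals ρ ts

  infix 4 _⊨_
  _⊨_ : ∀ {n} → Vec Carrier n → BasicFormula 𝓡 n → Set ℓ
  ρ ⊨ atom R ts = evals ρ ts ∈ rel R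

module _ {a s ℓ : Level} (𝓡 : SetWithLanguage a s ℓ) where
  open SetWithLanguage 𝓡

  -- Of the k + l variables, the first k are the free x₁,…,xₖ and the last l
  -- are the existentially quantified y₁,…,yₗ.
  Diophantine : ∀ {p k} → Pred (Vec Carrier k) p → Set (a ⊔ s ⊔ ℓ ⊔ p)
  Diophantine {k = k} S =
    ∃[ l ] ∃ λ (fs : List (BasicFormula 𝓡 (k + l))) →
      S ≐ (λ xs → ∃ λ (ys : Vec Carrier l) → All ((xs ++ ys) ⊨_) fs)

module _ {a b : Level} {A : Set a} {B : Set b} (d : A → B) where

  image : ∀ {p k} → Pred (Vec A k) p → Pred (Vec B k) (a ⊔ b ⊔ p)
  image S zs = ∃[ xs ] xs ∈ S × map d xs ≡ zs

  -- { (d x₁, …, d xₖ, d (f (x₁, …, xₖ))) }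
  graphImage : ∀ {k} → (Vec A k → A) → Pred (Vec B (ℕ.suc k)) (a ⊔ b)
  graphImage f zs = ∃[ xs ] map d xs ∷ʳ d (f xs) ≡ zs

module _ {a₁ s₁ ℓ₁ a₂ s₂ ℓ₂ : Level}
         (𝓡₁ : SetWithLanguage a₁ s₁ ℓ₁) (𝓡₂ : SetWithLanguage a₂ s₂ ℓ₂) where
  private
    module R₁ = SetWithLanguage 𝓡₁
    module R₂ = SetWithLanguage 𝓡₂

  -- The universe level p of the sets S is a parameter, as Agda cannot
  -- quantify over it inside a `Set`.
  DiophantineMap : (p : Level) → (R₁.Carrier → R₂.Carrier) →
                   Set (a₁ ⊔ s₁ ⊔ ℓ₁ ⊔ a₂ ⊔ s₂ ⊔ ℓ₂ ⊔ lsuc p)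
  DiophantineMap p d = ∀ {k} (S : Pred (Vec R₁.Carrier k) p) →
    Diophantine 𝓡₁ S → Diophantine 𝓡₂ (image d S)

{-# OPTIONS --safe #-}
module Submission where

-- Call a subset T of R₁^k transported by d when d(T) is Diophantine.  The idea
-- is to let the class of transported sets inherit the closure properties of
-- the Diophantine sets of R₂, and then to argue inside R₁ only.
--
-- The Diophantine sets include the full sets R^k and are closed under finite
-- intersection, preimage under a reindexing of coordinates, and projection
-- (existential quantification over trailing coordinates).  Transported sets
-- have the same closure properties.  Taking images under d commutes with
-- projections (`transported-∃`) and, as d is injective, with intersections
-- (`transported-∩`).  Also by injectivity, the image of the preimage of T
-- under a reindexing σ of n coordinates consists of the points of d(R₁)^n
-- whose reindexing by σ lies in d(T) (`transported-reindex`).  This needs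
-- d(R₁)^n to be Diophantine, which holds because d(R₁) is (`transported-U`).
--
-- By hypothesis the graphs of constants and functions are transported.  The
-- value of a function can be named by an existentially quantified variable
-- that is tied to the arguments by the graph (`transported-fun`), so by
-- induction on terms transported sets are stable under substitution of terms
-- for variables (`transported-term`).  Since the relations of the language are
-- transported by hypothesis, so is every set defined by a basic formula
-- (`transported-⊨`), and a Diophantine set is a projection of a finite
-- intersection of these.

open import Defs
open import Level using (Level; _⊔_)
open import Data.Nat.Base using (ℕ; zero; suc; _+_)
open import Data.Fin.Base using (Fin; zero; suc; _↑ˡ_; _↑ʳ_)
open import Data.Vec.Base
  using (Vec; []; _∷_; [_]; _++_; _∷ʳ_; lookup; map; allFin; splitAt)
open import Data.Vec.Properties
  using ( map-∘; map-cong; map-++; map-∷ʳ; lookup-map; lookup-++ˡ; lookup-++ʳ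
        ; map-lookup-allFin; ∷-injective; ++-injective; ∷ʳ-injective )
open import Data.List.Base as List using (List)
open import Data.List.Relation.Unary.All as All using (All)
import Data.List.Relation.Unary.All.Properties as All
open import Data.Product.Base using (∃; ∃-syntax; _×_; _,_; proj₁; proj₂)
open import Data.Unit.Base using (tt)
open import Function.Base using (id; _∘_)
open import Function.Bundles using (_⇔_; mk⇔; module Equivalence)
open import Function.Definitions using (Injective)
open import Relation.Unary using (Pred; _∈_; _≐_; _∩_; _⊢_; ｛_｝; U)
open import Relation.Unary.Properties using (≐-sym; ≐-trans)
open import Relation.Binary.PropositionalEquality.Core
  using (_≡_; refl; sym; trans; cong; cong₂; subst)
open import Relation.Binary.PropositionalEquality.Properties
  using (module ≡-Reasoning)
open SetWithLanguage using (Carrier; Con; Fun; Rel; con; fun; rel)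
open Equivalence using (to; from)

private
  variable
    a b p q : Level
    A : Set a
    B : Set b
    k l m n : ℕ

-- Preimages of S under pointwise equal maps.
≗⇒≐ : {f g : A → B} (S : Pred B p) → (∀ x → f x ≡ g x) → (f ⊢ S) ≐ (g ⊢ S)
≗⇒≐ S eq = (λ {x} → subst S (eq x)) , (λ {x} → subst S (sym (eq x)))

map-injective : {d : A → B} → Injective _≡_ _≡_ d →
                Injective _≡_ _≡_ (map {n = n} d)
map-injective inj {[]}     {[]}     _  = refl
map-injective inj {x ∷ xs} {y ∷ ys} eq with ∷-injective eq
... | dx≡dy , eqs = cong₂ _∷_ (inj dx≡dy) (map-injective inj eqs)

-- Reindexing of coordinates

-- The vector whose i-th coordinate is the σᵢ-th coordinate of xs.
pick : Vec (Fin n) k → Vec A n → Vec A k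
pick σ xs = map (lookup xs) σ

-- The indices of the first k, and of the last l, of k + l coordinates.
firsts : ∀ k l → Vec (Fin (k + l)) k
firsts k l = map (_↑ˡ l) (allFin k)

lasts : ∀ k l → Vec (Fin (k + l)) l
lasts k l = map (k ↑ʳ_) (allFin l)

pick-map : (f : A → B) (σ : Vec (Fin n) k) (xs : Vec A n) →
           pick σ (map f xs) ≡ map f (pick σ xs)
pick-map f σ xs =
  trans (map-cong (λ i → lookup-map i f xs) σ) (map-∘ f (lookup xs) σ)

-- A vector of indices can itself be reindexed; this composes reindexings.
pick-pick : (τ : Vec (Fin m) k) (σ : Vec (Fin n) m) (xs : Vec A n) →
            pick (pick τ σ) xs ≡ pick τ (pick σ xs)
pick-pick τ σ xs = sym (pick-map (lookup xs) τ σ)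

pick-++ : (σ : Vec (Fin n) k) (τ : Vec (Fin n) l) (xs : Vec A n) →
          pick (σ ++ τ) xs ≡ pick σ xs ++ pick τ xs
pick-++ σ τ xs = map-++ (lookup xs) σ τ

pick-↑ʳ : (xs : Vec A m) (ys : Vec A n) (σ : Vec (Fin n) k) →
          pick (map (m ↑ʳ_) σ) (xs ++ ys) ≡ pick σ ys
pick-↑ʳ xs ys σ =
  trans (sym (map-∘ (lookup (xs ++ ys)) _ σ)) (map-cong (lookup-++ʳ xs ys) σ)

pick-firsts : (xs : Vec A k) (ys : Vec A l) → pick (firsts k l) (xs ++ ys) ≡ xs
pick-firsts xs ys = begin
  pick (firsts _ _) (xs ++ ys)  ≡⟨ map-∘ (lookup (xs ++ ys)) _ (allFin _) ⟨
  map _ (allFin _)              ≡⟨ map-cong (lookup-++ˡ xs ys) (allFin _) ⟩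
  map (lookup xs) (allFin _)    ≡⟨ map-lookup-allFin xs ⟩
  xs                            ∎
  where open ≡-Reasoning

pick-lasts : (xs : Vec A k) (ys : Vec A l) → pick (lasts k l) (xs ++ ys) ≡ ys
pick-lasts xs ys = trans (pick-↑ʳ xs ys (allFin _)) (map-lookup-allFin ys)

-- The reindexing that keeps the first k coordinates and applies σ to the rest.
onLasts : ∀ k → Vec (Fin n) m → Vec (Fin (k + n)) (k + m)
onLasts k σ = firsts k _ ++ map (k ↑ʳ_) σ

pick-onLasts : (xs : Vec A k) (ys : Vec A n) (σ : Vec (Fin n) m) →
               pick (onLasts k σ) (xs ++ ys) ≡ xs ++ pick σ ys
pick-onLasts {k = k} xs ys σ =
  trans (pick-++ (firsts k _) (map (k ↑ʳ_) σ) (xs ++ ys))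
    (cong₂ _++_ (pick-firsts xs ys) (pick-↑ʳ xs ys σ))

-- Graphs of functions

module _ {A : Set a} where

  -- The points (x₁, …, xₖ, f(x₁, …, xₖ)).
  Graph : (Vec A k → A) → Pred (Vec A (suc k)) a
  Graph f v = ∃[ xs ] xs ∷ʳ f xs ≡ v

  image-Graph : {B : Set b} (d : A → B) (f : Vec A k → A) →
                graphImage d f ≐ image d (Graph f)
  image-Graph d f =
    (λ (xs , eq) → xs ∷ʳ f xs , (xs , refl) , trans (map-∷ʳ d (f xs) xs) eq) ,
    (λ { (_ , (xs , refl) , eq) →
         xs , trans (sym (map-∷ʳ d (f xs) xs)) eq })

  -- A constant is a function of no arguments; its graph is a singleton.
  image-Graph-const : {B : Set b} (d : A → B) (c : A) →
                      ｛ [ d c ] ｝ ≐ image d (Graph {k = 0} (λ _ → c))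
  image-Graph-const d c =
    (λ eq → [ c ] , ([] , refl) , eq) ,
    (λ { (_ , ([] , refl) , eq) → eq })

-- Closure properties of Diophantine sets

module _ {a s ℓ : Level} {𝓡 : SetWithLanguage a s ℓ} where

  -- Replaces the i-th variable by the σᵢ-th one, which amounts to reindexing
  -- the assignment by σ (`eval-rename`).
  rename  : Vec (Fin m) n → Term 𝓡 n → Term 𝓡 m
  renames : Vec (Fin m) n → Vec (Term 𝓡 n) k → Vec (Term 𝓡 m) k

  rename σ (var i)    = var (lookup σ i)
  rename σ (const c)  = const c
  rename σ (app f ts) = app f (renames σ ts)

  renames σ []       = []
  renames σ (t ∷ ts) = rename σ t ∷ renames σ ts

  eval-rename : (σ : Vec (Fin m) n) (ρ : Vec (Carrier 𝓡) m) (t : Term 𝓡 n) →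
                eval ρ (rename σ t) ≡ eval (pick σ ρ) t
  evals-renames : (σ : Vec (Fin m) n) (ρ : Vec (Carrier 𝓡) m)
                  (ts : Vec (Term 𝓡 n) k) →
                  evals ρ (renames σ ts) ≡ evals (pick σ ρ) ts

  eval-rename σ ρ (var i)    = sym (lookup-map i (lookup ρ) σ)
  eval-rename σ ρ (const c)  = refl
  eval-rename σ ρ (app f ts) = cong (fun 𝓡 f) (evals-renames σ ρ ts)

  evals-renames σ ρ []       = refl
  evals-renames σ ρ (t ∷ ts) =
    cong₂ _∷_ (eval-rename σ ρ t) (evals-renames σ ρ ts)

  renameᶠ : Vec (Fin m) n → BasicFormula 𝓡 n → BasicFormula 𝓡 m
  renameᶠ σ (atom R ts) = atom R (renames σ ts)

  ⊨-rename : (σ : Vec (Fin m) n) (ρ : Vec (Carrier 𝓡) m)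
             (f : BasicFormula 𝓡 n) → (ρ ⊨ renameᶠ σ f) ≡ (pick σ ρ ⊨ f)
  ⊨-rename σ ρ (atom R ts) = cong (rel 𝓡 R) (evals-renames σ ρ ts)

  -- The set of assignments that satisfy a system of basic formulas.
  Solutions : List (BasicFormula 𝓡 n) → Pred (Vec (Carrier 𝓡) n) (s ⊔ ℓ)
  Solutions fs ρ = All (ρ ⊨_) fs

  solutions-rename : (σ : Vec (Fin m) n) (fs : List (BasicFormula 𝓡 n))
                     {ρ : Vec (Carrier 𝓡) m} {ρ′ : Vec (Carrier 𝓡) n} →
                     pick σ ρ ≡ ρ′ →
                     ρ ∈ Solutions (List.map (renameᶠ σ) fs) ⇔
                     ρ′ ∈ Solutions fs
  solutions-rename σ fs {ρ} refl = mk⇔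
    (All.map (λ {f} → subst id (⊨-rename σ ρ f)) ∘ All.map⁻)
    (All.map⁺ ∘ All.map (λ {f} → subst id (sym (⊨-rename σ ρ f))))

module _ {a s ℓ : Level} (𝓡 : SetWithLanguage a s ℓ) where
  private
    C = Carrier 𝓡

  diophantine-resp : {S : Pred (Vec C k) p} {T : Pred (Vec C k) q} →
                     S ≐ T → Diophantine 𝓡 S → Diophantine 𝓡 T
  diophantine-resp S≐T (l , fs , S≐fs) = l , fs , ≐-trans (≐-sym S≐T) S≐fs

  diophantine-U : Diophantine 𝓡 {k = k} U
  diophantine-U = 0 , List.[] , (λ _ → [] , All.[]) , (λ _ → tt)

  -- The two systems get disjoint blocks of quantified variables.
  diophantine-∩ : {S : Pred (Vec C k) p} {T : Pred (Vec C k) q} →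
                  Diophantine 𝓡 S → Diophantine 𝓡 T → Diophantine 𝓡 (S ∩ T)
  diophantine-∩ {k = k} (l , fs , S⊆ , S⊇) (l′ , gs , T⊆ , T⊇) =
    l + l′ , fs′ List.++ gs′ ,
    (λ {xs} (xs∈S , xs∈T) →
      let ys , ⊨fs = S⊆ xs∈S
          zs , ⊨gs = T⊆ xs∈T
      in ys ++ zs ,
         All.++⁺
           (fs-iff xs (ys ++ zs) (pick-firsts ys zs) .from ⊨fs)
           (gs-iff xs (ys ++ zs) (pick-lasts ys zs) .from ⊨gs)) ,
    (λ {xs} (yzs , ⊨fs′++gs′) →
      let ⊨fs′ , ⊨gs′ = All.++⁻ fs′ ⊨fs′++gs′
      in S⊇ (pick (firsts l l′) yzs , fs-iff xs yzs refl .to ⊨fs′) ,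
         T⊇ (pick (lasts l l′) yzs , gs-iff xs yzs refl .to ⊨gs′))
    where
    σ = onLasts k (firsts l l′)
    τ = onLasts k (lasts l l′)

    fs′ = List.map (renameᶠ σ) fs
    gs′ = List.map (renameᶠ τ) gs

    fs-iff : ∀ xs yzs {ys} → pick (firsts l l′) yzs ≡ ys →
             xs ++ yzs ∈ Solutions fs′ ⇔ xs ++ ys ∈ Solutions fs
    fs-iff xs yzs refl = solutions-rename σ fs (pick-onLasts xs yzs _)

    gs-iff : ∀ xs yzs {zs} → pick (lasts l l′) yzs ≡ zs →
             xs ++ yzs ∈ Solutions gs′ ⇔ xs ++ zs ∈ Solutions gs
    gs-iff xs yzs refl = solutions-rename τ gs (pick-onLasts xs yzs _)

  diophantine-reindex : (σ : Vec (Fin n) k) {S : Pred (Vec C k) p} →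
                        Diophantine 𝓡 S → Diophantine 𝓡 (pick σ ⊢ S)
  diophantine-reindex {n = n} σ (l , fs , S⊆ , S⊇) =
    l , List.map (renameᶠ τ) fs ,
    (λ {xs} xs∈S → let ys , ⊨fs = S⊆ xs∈S in ys , iff xs ys .from ⊨fs) ,
    (λ {xs} (ys , ⊨fs) → S⊇ (ys , iff xs ys .to ⊨fs))
    where
    τ = pick σ (firsts n l) ++ lasts n l

    pick-τ : ∀ xs ys → pick τ (xs ++ ys) ≡ pick σ xs ++ ys
    pick-τ xs ys = trans (pick-++ (pick σ (firsts n l)) _ (xs ++ ys))
      (cong₂ _++_
        (trans (pick-pick σ (firsts n l) (xs ++ ys))
          (cong (pick σ) (pick-firsts xs ys)))
        (pick-lasts xs ys))

    iff : ∀ xs ys → xs ++ ys ∈ Solutions (List.map (renameᶠ τ) fs) ⇔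
                    pick σ xs ++ ys ∈ Solutions fs
    iff xs ys = solutions-rename τ fs (pick-τ xs ys)

  -- The coordinates ys join the quantified variables of S.
  diophantine-∃ : {S : Pred (Vec C (k + l)) p} → Diophantine 𝓡 S →
                  Diophantine 𝓡 (λ xs → ∃[ ys ] xs ++ ys ∈ S)
  diophantine-∃ {k = k} {l = l} (l′ , fs , S⊆ , S⊇) =
    l + l′ , List.map (renameᶠ τ) fs ,
    (λ {xs} (ys , xys∈S) →
      let zs , ⊨fs = S⊆ xys∈S
      in ys ++ zs ,
         iff xs (ys ++ zs) (pick-firsts ys zs) (pick-lasts ys zs) .from ⊨fs) ,
    (λ {xs} (yzs , ⊨fs) →
      pick (firsts l l′) yzs ,
      S⊇ (pick (lasts l l′) yzs , iff xs yzs refl refl .to ⊨fs))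
    where
    τ = onLasts k (firsts l l′) ++ map (k ↑ʳ_) (lasts l l′)

    iff : ∀ xs yzs {ys zs} →
          pick (firsts l l′) yzs ≡ ys → pick (lasts l l′) yzs ≡ zs →
          xs ++ yzs ∈ Solutions (List.map (renameᶠ τ) fs) ⇔
          (xs ++ ys) ++ zs ∈ Solutions fs
    iff xs yzs refl refl = solutions-rename τ fs
      (trans (pick-++ (onLasts k (firsts l l′)) _ (xs ++ yzs))
        (cong₂ _++_ (pick-onLasts xs yzs _) (pick-↑ʳ xs yzs _)))

-- Sets whose image under d is Diophantine

module _ {a₁ s₁ ℓ₁ a₂ s₂ ℓ₂ : Level}
         (𝓡₁ : SetWithLanguage a₁ s₁ ℓ₁) (𝓡₂ : SetWithLanguage a₂ s₂ ℓ₂)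
         (d : Carrier 𝓡₁ → Carrier 𝓡₂) where
  private
    C = Carrier 𝓡₁

  -- T need not be Diophantine itself; d is a Diophantine map exactly when
  -- every Diophantine set is transported.
  Transported : Pred (Vec C k) p → Set (a₁ ⊔ a₂ ⊔ s₂ ⊔ ℓ₂ ⊔ p)
  Transported T = Diophantine 𝓡₂ (image d T)

  transported-resp : {S : Pred (Vec C k) p} {T : Pred (Vec C k) q} →
                     S ≐ T → Transported S → Transported T
  transported-resp (S⊆T , T⊆S) = diophantine-resp 𝓡₂
    ((λ (xs , xs∈S , eq) → xs , S⊆T xs∈S , eq) ,
     (λ (xs , xs∈T , eq) → xs , T⊆S xs∈T , eq))

  transported-∃ : {T : Pred (Vec C (k + l)) p} → Transported T →
                  Transported (λ xs → ∃[ ys ] xs ++ ys ∈ T)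
  transported-∃ {k = k} {l = l} {T = T} DT =
    diophantine-resp 𝓡₂ (sub , sup) (diophantine-∃ 𝓡₂ DT)
    where
    sub : ∀ {zs : Vec _ k} → (∃[ ws ] zs ++ ws ∈ image d T) →
          zs ∈ image d (λ xs → ∃[ ys ] xs ++ ys ∈ T)
    sub {zs} (ws , xys , xys∈T , eq) with splitAt k xys
    ... | xs , ys , refl =
      xs , (ys , xys∈T) ,
      proj₁ (++-injective (map d xs) zs (trans (sym (map-++ d xs ys)) eq))

    sup : ∀ {zs : Vec _ k} → zs ∈ image d (λ xs → ∃[ ys ] xs ++ ys ∈ T) →
          ∃[ ws ] zs ++ ws ∈ image d T
    sup (xs , (ys , xys∈T) , refl) =
      map d ys , xs ++ ys , xys∈T , map-++ d xs ys

  module _ (inj : Injective _≡_ _≡_ d) where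

    transported-∩ : {S : Pred (Vec C k) p} {T : Pred (Vec C k) q} →
                    Transported S → Transported T → Transported (S ∩ T)
    transported-∩ {S = S} {T = T} DS DT =
      diophantine-resp 𝓡₂ (sub , sup) (diophantine-∩ 𝓡₂ DS DT)
      where
      sub : ∀ {zs} → zs ∈ image d S ∩ image d T → zs ∈ image d (S ∩ T)
      sub ((xs , xs∈S , refl) , (ys , ys∈T , eq)) =
        xs , (xs∈S , subst T (map-injective inj eq) ys∈T) , refl

      sup : ∀ {zs} → zs ∈ image d (S ∩ T) → zs ∈ image d S ∩ image d T
      sup (xs , (xs∈S , xs∈T) , eq) = (xs , xs∈S , eq) , (xs , xs∈T , eq)

    module _ (d-range : Diophantine 𝓡₂ (image d {k = 1} U)) where

      -- A point lies in d(R₁)^(1+k) exactly when its first coordinate lies in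
      -- d(R₁) and the others form a point of d(R₁)^k.
      transported-U : ∀ k → Transported {k = k} U
      transported-U zero =
        diophantine-resp 𝓡₂ (sub , (λ _ → tt)) (diophantine-U 𝓡₂)
        where
        sub : ∀ {zs : Vec _ 0} → zs ∈ U → zs ∈ image d U
        sub {[]} _ = [] , tt , refl
      transported-U (suc k) = diophantine-resp 𝓡₂ (sub , sup)
        (diophantine-∩ 𝓡₂
          (diophantine-reindex 𝓡₂ [ zero ] d-range)
          (diophantine-reindex 𝓡₂ (lasts 1 k) (transported-U k)))
        where
        sub : ∀ {zs} → zs ∈ (pick [ zero ] ⊢ image d U) ∩
                            (pick (lasts 1 k) ⊢ image d U) →
              zs ∈ image d U
        sub {z ∷ zs} ((x ∷ [] , _ , refl) , (xs , _ , eq)) =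
          x ∷ xs , tt , cong (d x ∷_) (trans eq (pick-lasts [ d x ] zs))

        sup : ∀ {zs} → zs ∈ image d U →
              zs ∈ (pick [ zero ] ⊢ image d U) ∩
                   (pick (lasts 1 k) ⊢ image d U)
        sup (x ∷ xs , _ , refl) =
          ([ x ] , tt , refl) ,
          (xs , tt , sym (pick-lasts [ d x ] (map d xs)))

      transported-reindex : (σ : Vec (Fin n) k) {T : Pred (Vec C k) p} →
                            Transported T → Transported (pick σ ⊢ T)
      transported-reindex σ {T = T} DT = diophantine-resp 𝓡₂ (sub , sup)
        (diophantine-∩ 𝓡₂ (transported-U _) (diophantine-reindex 𝓡₂ σ DT))
        where
        sub : ∀ {zs} → zs ∈ image d U ∩ (pick σ ⊢ image d T) →
              zs ∈ image d (pick σ ⊢ T)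
        sub ((xs , _ , refl) , (ys , ys∈T , eq)) =
          xs ,
          subst T (map-injective inj (trans eq (pick-map d σ xs))) ys∈T ,
          refl

        sup : ∀ {zs} → zs ∈ image d (pick σ ⊢ T) →
              zs ∈ image d U ∩ (pick σ ⊢ image d T)
        sup (xs , xs∈T , refl) =
          (xs , tt , refl) , (pick σ xs , xs∈T , sym (pick-map d σ xs))

      -- Substitution of terms

      -- The function f is applied to the first k coordinates of w, and its
      -- value is put in front of the remaining ones.  With w = us ++ v, the
      -- condition f(us) ∷ v ∈ T says that some x satisfies x ∷ v ∈ T and
      -- us ∷ʳ x ∈ Graph f.
      transported-fun : (f : Vec C k → C) → Transported (Graph f) →
                        {T : Pred (Vec C (suc m)) p} → Transported T →
                        Transported (λ (w : Vec C (k + m)) →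
                          f (pick (firsts k m) w) ∷ pick (lasts k m) w ∈ T)
      transported-fun {k = k} {m = m} f DG {T} DT =
        transported-resp ((λ {w} → sub {w}) , (λ {w} → sup {w}))
          (transported-∃ {k = k + m} {l = 1}
            (transported-∩ (transported-reindex σ DT)
                           (transported-reindex τ DG)))
        where
        -- The index of the quantified variable x.
        new : Fin (k + m + 1)
        new = (k + m) ↑ʳ zero

        -- From w ++ [ x ], σ reads off x ∷ v and τ reads off us ∷ʳ x.
        σ = new ∷ pick (lasts k m) (firsts (k + m) 1)
        τ = pick (firsts k m) (firsts (k + m) 1) ∷ʳ new

        pick-old : (α : Vec (Fin (k + m)) l) (w : Vec C (k + m)) (x : C) →
                   pick (pick α (firsts (k + m) 1)) (w ++ [ x ]) ≡ pick α w
        pick-old α w x =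
          trans (pick-pick α (firsts (k + m) 1) (w ++ [ x ]))
                (cong (pick α) (pick-firsts w [ x ]))

        pick-σ : ∀ w x → pick σ (w ++ [ x ]) ≡ x ∷ pick (lasts k m) w
        pick-σ w x =
          cong₂ _∷_ (lookup-++ʳ w [ x ] zero) (pick-old (lasts k m) w x)

        pick-τ : ∀ w x → pick τ (w ++ [ x ]) ≡ pick (firsts k m) w ∷ʳ x
        pick-τ w x =
          trans (map-∷ʳ (lookup (w ++ [ x ])) new _)
            (cong₂ _∷ʳ_ (pick-old (firsts k m) w x)
                        (lookup-++ʳ w [ x ] zero))

        S : Pred (Vec C (k + m)) _
        S w = f (pick (firsts k m) w) ∷ pick (lasts k m) w ∈ T

        S′ : Pred (Vec C (k + m)) _
        S′ w = ∃ λ (xs : Vec C 1) →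
          w ++ xs ∈ (pick σ ⊢ T) ∩ (pick τ ⊢ Graph f)

        sub : ∀ {w} → w ∈ S′ → w ∈ S
        sub {w} (x ∷ [] , ∈T , us , eq)
          with ∷ʳ-injective us (pick (firsts k m) w) (trans eq (pick-τ w x))
        ... | refl , refl = subst T (pick-σ w x) ∈T

        sup : ∀ {w} → w ∈ S → w ∈ S′
        sup {w} ∈T =
          [ x ] , subst T (sym (pick-σ w x)) ∈T ,
          pick (firsts k m) w , sym (pick-τ w x)
          where x = f (pick (firsts k m) w)

      module _ (con-graph : (c : Con 𝓡₁) →
                            Transported (Graph {k = 0} (λ _ → con 𝓡₁ c)))
               (fun-graph : ∀ {k} (f : Fun 𝓡₁ k) →
                            Transported (Graph (fun 𝓡₁ f))) where

        -- The term t takes its variables from the coordinates σ of v.  The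
        -- point v is kept next to the value of t, so that several terms in
        -- the same variables can be treated one after the other.
        transported-term :
          (t : Term 𝓡₁ n) (σ : Vec (Fin m) n) {T : Pred (Vec C (suc m)) p} →
          Transported T → Transported (λ v → eval (pick σ v) t ∷ v ∈ T)
        transported-terms :
          (ts : Vec (Term 𝓡₁ n) k) (σ : Vec (Fin m) n)
          {T : Pred (Vec C (k + m)) p} →
          Transported T → Transported (λ v → evals (pick σ v) ts ++ v ∈ T)

        transported-term (var i) σ {T} DT =
          transported-resp
            (≗⇒≐ T (λ v → cong₂ _∷_ (sym (lookup-map i (lookup v) σ))
                                    (map-lookup-allFin v)))
            (transported-reindex (lookup σ i ∷ allFin _) DT)
        transported-term (const c) σ {T} DT =
          transported-resp
            (≗⇒≐ T (λ v → cong (con 𝓡₁ c ∷_) (pick-lasts [] v)))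
            (transported-fun (λ _ → con 𝓡₁ c) (con-graph c) DT)
        transported-term (app f ts) σ {T} DT =
          transported-resp
            (≗⇒≐ T (λ v → let us = evals (pick σ v) ts in
              cong₂ _∷_ (cong (fun 𝓡₁ f) (pick-firsts us v))
                        (pick-lasts us v)))
            (transported-terms ts σ
              (transported-fun (fun 𝓡₁ f) (fun-graph f) DT))

        transported-terms []       σ DT = DT
        -- The values of ts come before v, so the variables of t move to the
        -- coordinates k + σ.
        transported-terms {k = suc k} (t ∷ ts) σ {T} DT =
          transported-resp
            (≗⇒≐ T (λ v → let us = evals (pick σ v) ts in
              cong (λ ρ → eval ρ t ∷ us ++ v) (pick-↑ʳ us v σ)))
            (transported-terms ts σ
              (transported-term t (map (k ↑ʳ_) σ) DT))

        module _ (rel-image : ∀ {k} (R : Rel 𝓡₁ k) →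
                              Transported (rel 𝓡₁ R)) where

          transported-⊨ : (f : BasicFormula 𝓡₁ n) → Transported (_⊨ f)
          transported-⊨ {n = n} (atom {k} R ts) =
            transported-resp
              (≗⇒≐ (rel 𝓡₁ R) (λ ρ →
                trans (pick-firsts _ ρ)
                      (cong (λ ρ′ → evals ρ′ ts) (map-lookup-allFin ρ))))
              (transported-terms ts (allFin n)
                (transported-reindex (firsts k n) (rel-image R)))

          transported-solutions : (fs : List (BasicFormula 𝓡₁ n)) →
                                  Transported (Solutions fs)
          transported-solutions List.[] =
            transported-resp ((λ _ → All.[]) , (λ _ → tt)) (transported-U _)
          transported-solutions (f List.∷ fs) =
            transported-resp
              ((λ (⊨f , ⊨fs) → ⊨f All.∷ ⊨fs) ,
               (λ { (⊨f All.∷ ⊨fs) → ⊨f , ⊨fs }))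
              (transported-∩ (transported-⊨ f) (transported-solutions fs))

          transported-diophantine : {S : Pred (Vec C k) p} →
                                    Diophantine 𝓡₁ S → Transported S
          transported-diophantine (l , fs , S≐fs) =
            transported-resp (≐-sym S≐fs)
              (transported-∃ (transported-solutions fs))

theorem1p4 : ∀ {a₁ s₁ ℓ₁ a₂ s₂ ℓ₂ : Level}
    (𝓡₁ : SetWithLanguage a₁ s₁ ℓ₁) (𝓡₂ : SetWithLanguage a₂ s₂ ℓ₂)
    (d : Carrier 𝓡₁ → Carrier 𝓡₂) →
    Injective _≡_ _≡_ d →
    (∀ (c : Con 𝓡₁) → Diophantine 𝓡₂ ｛ [ d (con 𝓡₁ c) ] ｝) →
    (∀ {k} (f : Fun 𝓡₁ k) → Diophantine 𝓡₂ (graphImage d (fun 𝓡₁ f))) →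
    (∀ {k} (R : Rel 𝓡₁ k) → Diophantine 𝓡₂ (image d (rel 𝓡₁ R))) →
    Diophantine 𝓡₂ (image d {k = 1} U) →
    ∀ (p : Level) → DiophantineMap 𝓡₁ 𝓡₂ p d
theorem1p4 𝓡₁ 𝓡₂ d inj con-dioph fun-dioph rel-dioph range-dioph p S =
  transported-diophantine 𝓡₁ 𝓡₂ d inj range-dioph
    (λ c → diophantine-resp 𝓡₂ (image-Graph-const d (con 𝓡₁ c)) (con-dioph c))
    (λ f → diophantine-resp 𝓡₂ (image-Graph d (fun 𝓡₁ f)) (fun-dioph f))
    rel-dioph
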